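{- Let $X\subseteq\{0,1\}^n$, let $Q$ be a real symmetric $n\times n$ matrix with rows $Q_1,\dots,Q_n$, let $\bar X\subseteq\mathbb{R}^n$ be a relaxation of $X$, and let $\gamma^i_{\min}=\min\{Q_i x: x\in\bar X\}$ and $\gamma^i_{\max}=\max\{Q_i x: x\in\bar X\}$. Then for every $x\in X$ and all $i=1,\dots,n$, $$x_i Q_i x=\max\{\gamma^i_{\min}x_i,\; Q_i x+\gamma^i_{\max}x_i-\gamma^i_{\max}\},$$ $$x_i Q_i x=\min\{\gamma^i_{\max}x_i,\; Q_i x+\gamma^i_{\min}x_i-\gamma^i_{\min}\}.$$
   Context: A relaxation of $X$ is a set $\bar X\subseteq\mathbb{R}^n$ with $X\subseteq\bar X$; it is chosen so that the minima and maxima $\gamma^i_{\min},\gamma^i_{\max}$ exist (are attained and finite). $Q_i x$ denotes the scalar product of the $i$-th row of $Q$ with $x$, and $x_iQ_ix$ is the product of the scalars $x_i$ and $Q_ix$. -}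

module Defs where

open import Data.Nat.Base as ℕ using (ℕ)
import Data.Nat.Properties as ℕ
open import Data.Product.Base using (_×_; _,_; ∃-syntax; proj₁; proj₂)
open import Data.Rational.Base as ℚ using (ℚ; 0ℚ; 1ℚ; ½; ∣_∣)
import Data.Rational.Properties as ℚ
open import Data.Rational.Solver using (module +-*-Solver)
open import Data.Sum.Base using (_⊎_; inj₁; inj₂)
open import Data.Vec.Functional using (Vector; foldr; zipWith)
open import Level using (Level; 0ℓ)
open import Relation.Binary.PropositionalEquality
  using (_≡_; refl; sym; trans; cong; cong₂; subst)
open import Relation.Unary using (Pred; _∈_)

private
  variable
    ℓ : Level
    n : ℕ

open +-*-Solver

module RationalDistance where

  d-sym : ∀ p q → ∣ p ℚ.- q ∣ ≡ ∣ q ℚ.- p ∣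
  d-sym p q = trans (cong ∣_∣ (solve 2 (λ p q → p :- q := :- (q :- p)) refl p q))
                    (ℚ.∣-p∣≡∣p∣ (q ℚ.- p))

  p≤∣p∣ : ∀ p → p ℚ.≤ ∣ p ∣
  p≤∣p∣ p with ℚ.≤-total 0ℚ p
  ... | inj₁ 0≤p = ℚ.≤-reflexive (sym (ℚ.0≤p⇒∣p∣≡p 0≤p))
  ... | inj₂ p≤0 = ℚ.≤-trans p≤0 (ℚ.0≤∣p∣ p)

  p≤q+d : ∀ p q → p ℚ.≤ q ℚ.+ ∣ p ℚ.- q ∣
  p≤q+d p q = begin
    p                  ≡⟨ solve 2 (λ p q → p := q :+ (p :- q)) refl p q ⟩
    q ℚ.+ (p ℚ.- q)    ≤⟨ ℚ.+-monoʳ-≤ q (p≤∣p∣ (p ℚ.- q)) ⟩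
    q ℚ.+ ∣ p ℚ.- q ∣  ∎
    where open ℚ.≤-Reasoning

  p-q≤ : ∀ p q {b} → p ℚ.≤ q ℚ.+ b → p ℚ.- q ℚ.≤ b
  p-q≤ p q {b} p≤q+b = begin
    p ℚ.- q          ≤⟨ ℚ.+-monoˡ-≤ (ℚ.- q) p≤q+b ⟩
    q ℚ.+ b ℚ.- q    ≡⟨ solve 2 (λ q b → q :+ b :- q := b) refl q b ⟩
    b                ∎
    where open ℚ.≤-Reasoning

  d≤ : ∀ p q {b} → p ℚ.≤ q ℚ.+ b → q ℚ.≤ p ℚ.+ b → ∣ p ℚ.- q ∣ ℚ.≤ b
  d≤ p q {b} p≤q+b q≤p+b with ℚ.∣p∣≡p∨∣p∣≡-p (p ℚ.- q)
  ... | inj₁ eq = subst (ℚ._≤ b) (sym eq) (p-q≤ p q p≤q+b)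
  ... | inj₂ eq = subst (ℚ._≤ b)
          (sym (trans eq (solve 2 (λ p q → :- (p :- q) := q :- p) refl p q)))
          (p-q≤ q p q≤p+b)

  +-mono-pos : ∀ p {b c} → 0ℚ ℚ.≤ c → p ℚ.≤ b → p ℚ.≤ b ℚ.+ c
  +-mono-pos p 0≤c p≤b = subst (ℚ._≤ _) (ℚ.+-identityʳ p) (ℚ.+-mono-≤ p≤b 0≤c)

  NonExpansive : (ℚ → ℚ → ℚ) → Set
  NonExpansive f = ∀ p p′ q q′ →
    ∣ f p q ℚ.- f p′ q′ ∣ ℚ.≤ ∣ p ℚ.- p′ ∣ ℚ.+ ∣ q ℚ.- q′ ∣

  +-nonExpansive : NonExpansive ℚ._+_
  +-nonExpansive p p′ q q′ = begin
    ∣ p ℚ.+ q ℚ.- (p′ ℚ.+ q′) ∣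
      ≡⟨ cong ∣_∣ (solve 4 (λ p p′ q q′ →
           p :+ q :- (p′ :+ q′) := (p :- p′) :+ (q :- q′)) refl p p′ q q′) ⟩
    ∣ (p ℚ.- p′) ℚ.+ (q ℚ.- q′) ∣
      ≤⟨ ℚ.∣p+q∣≤∣p∣+∣q∣ (p ℚ.- p′) (q ℚ.- q′) ⟩
    ∣ p ℚ.- p′ ∣ ℚ.+ ∣ q ℚ.- q′ ∣ ∎
    where open ℚ.≤-Reasoning

  +-shift₁ : ∀ p p′ q q′ → p ℚ.≤ p′ ℚ.+ (∣ p ℚ.- p′ ∣ ℚ.+ ∣ q ℚ.- q′ ∣)
  +-shift₁ p p′ q q′ = subst (p ℚ.≤_) (ℚ.+-assoc p′ _ _)
    (+-mono-pos p (ℚ.0≤∣p∣ (q ℚ.- q′)) (p≤q+d p p′))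

  +-shift₂ : ∀ p p′ q q′ → q ℚ.≤ q′ ℚ.+ (∣ p ℚ.- p′ ∣ ℚ.+ ∣ q ℚ.- q′ ∣)
  +-shift₂ p p′ q q′ = subst (λ b → q ℚ.≤ q′ ℚ.+ b)
    (ℚ.+-comm ∣ q ℚ.- q′ ∣ ∣ p ℚ.- p′ ∣) (+-shift₁ q q′ p p′)

  d-swap : ∀ p p′ q q′ → ∣ p′ ℚ.- p ∣ ℚ.+ ∣ q′ ℚ.- q ∣ ≡ ∣ p ℚ.- p′ ∣ ℚ.+ ∣ q ℚ.- q′ ∣
  d-swap p p′ q q′ = cong₂ ℚ._+_ (d-sym p′ p) (d-sym q′ q)

  ⊔-nonExpansive : NonExpansive ℚ._⊔_
  ⊔-nonExpansive p p′ q q′ = d≤ (p ℚ.⊔ q) (p′ ℚ.⊔ q′) (half p p′ q q′)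
    (subst (λ b → p′ ℚ.⊔ q′ ℚ.≤ (p ℚ.⊔ q) ℚ.+ b) (d-swap p p′ q q′) (half p′ p q′ q))
    where
    half : ∀ p p′ q q′ →
      p ℚ.⊔ q ℚ.≤ (p′ ℚ.⊔ q′) ℚ.+ (∣ p ℚ.- p′ ∣ ℚ.+ ∣ q ℚ.- q′ ∣)
    half p p′ q q′ = ℚ.⊔-lub
      (ℚ.≤-trans (+-shift₁ p p′ q q′) (ℚ.+-monoˡ-≤ _ (ℚ.p≤p⊔q p′ q′)))
      (ℚ.≤-trans (+-shift₂ p p′ q q′) (ℚ.+-monoˡ-≤ _ (ℚ.p≤q⊔p p′ q′)))

  ⊓-nonExpansive : NonExpansive ℚ._⊓_
  ⊓-nonExpansive p p′ q q′ = d≤ (p ℚ.⊓ q) (p′ ℚ.⊓ q′) (half p p′ q q′)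
    (subst (λ b → p′ ℚ.⊓ q′ ℚ.≤ (p ℚ.⊓ q) ℚ.+ b) (d-swap p p′ q q′) (half p′ p q′ q))
    where
    half : ∀ p p′ q q′ →
      p ℚ.⊓ q ℚ.≤ (p′ ℚ.⊓ q′) ℚ.+ (∣ p ℚ.- p′ ∣ ℚ.+ ∣ q ℚ.- q′ ∣)
    half p p′ q q′ with ℚ.⊓-sel p′ q′
    ... | inj₁ eq = subst (λ r → p ℚ.⊓ q ℚ.≤ r ℚ.+ (∣ p ℚ.- p′ ∣ ℚ.+ ∣ q ℚ.- q′ ∣)) (sym eq)
                      (ℚ.≤-trans (ℚ.p⊓q≤p p q) (+-shift₁ p p′ q q′))
    ... | inj₂ eq = subst (λ r → p ℚ.⊓ q ℚ.≤ r ℚ.+ (∣ p ℚ.- p′ ∣ ℚ.+ ∣ q ℚ.- q′ ∣)) (sym eq)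
                      (ℚ.≤-trans (ℚ.p⊓q≤q p q) (+-shift₂ p p′ q q′))

  halve : ∀ ε → ½ ℚ.* ε ℚ.+ ½ ℚ.* ε ≡ ε
  halve = solve 1 (λ ε → con ½ :* ε :+ con ½ :* ε := ε) refl

  *-pos : ∀ {p q} → 0ℚ ℚ.< p → 0ℚ ℚ.< q → 0ℚ ℚ.< p ℚ.* q
  *-pos {p} {q} 0<p 0<q = subst (ℚ._< p ℚ.* q) (ℚ.*-zeroʳ p)
    (ℚ.*-monoʳ-<-pos p {{ℚ.positive 0<p}} 0<q)

  half-pos : ∀ {ε} → 0ℚ ℚ.< ε → 0ℚ ℚ.< ½ ℚ.* ε
  half-pos = *-pos (ℚ.positive⁻¹ ½)

  shrink : ∀ {K ε} → 0ℚ ℚ.< K → 0ℚ ℚ.< ε →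
           ∃[ δ ] (0ℚ ℚ.< δ × K ℚ.* δ ≡ ½ ℚ.* ε)
  shrink {K} {ε} 0<K 0<ε = 1/K ℚ.* (½ ℚ.* ε) , *-pos 0<1/K (half-pos 0<ε) ,
    trans (sym (ℚ.*-assoc K 1/K (½ ℚ.* ε)))
      (trans (cong (ℚ._* (½ ℚ.* ε)) (ℚ.*-inverseʳ K {{K≢0}})) (ℚ.*-identityˡ (½ ℚ.* ε)))
    where
    K≢0 = ℚ.pos⇒nonZero K {{ℚ.positive 0<K}}
    1/K = ℚ.1/_ K {{K≢0}}
    0<1/K : 0ℚ ℚ.< 1/K
    0<1/K = ℚ.positive⁻¹ 1/K {{ℚ.1/pos⇒pos K {{ℚ.positive 0<K}}}}

  mul-close : ∀ {K δ} p d → 0ℚ ℚ.< K → ∣ p ∣ ℚ.≤ K → ∣ d ∣ ℚ.< δ →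
              ∣ p ℚ.* d ∣ ℚ.< K ℚ.* δ
  mul-close {K} {δ} p d 0<K p≤K d<δ = begin-strict
    ∣ p ℚ.* d ∣      ≡⟨ ℚ.∣p*q∣≡∣p∣*∣q∣ p d ⟩
    ∣ p ∣ ℚ.* ∣ d ∣  ≤⟨ ℚ.*-monoʳ-≤-nonNeg ∣ d ∣ {{ℚ.∣-∣-nonNeg d}} p≤K ⟩
    K ℚ.* ∣ d ∣      <⟨ ℚ.*-monoʳ-<-pos K {{ℚ.positive 0<K}} d<δ ⟩
    K ℚ.* δ          ∎
    where open ℚ.≤-Reasoning

  *-distance : ∀ p p′ q q′ → ∣ p ℚ.* q ℚ.- p′ ℚ.* q′ ∣ ℚ.≤
                             ∣ p ℚ.* (q ℚ.- q′) ∣ ℚ.+ ∣ q′ ℚ.* (p ℚ.- p′) ∣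
  *-distance p p′ q q′ = begin
    ∣ p ℚ.* q ℚ.- p′ ℚ.* q′ ∣
      ≡⟨ cong ∣_∣ (solve 4 (λ p p′ q q′ →
           p :* q :- p′ :* q′ := p :* (q :- q′) :+ q′ :* (p :- p′)) refl p p′ q q′) ⟩
    ∣ p ℚ.* (q ℚ.- q′) ℚ.+ q′ ℚ.* (p ℚ.- p′) ∣
      ≤⟨ ℚ.∣p+q∣≤∣p∣+∣q∣ (p ℚ.* (q ℚ.- q′)) (q′ ℚ.* (p ℚ.- p′)) ⟩
    ∣ p ℚ.* (q ℚ.- q′) ∣ ℚ.+ ∣ q′ ℚ.* (p ℚ.- p′) ∣ ∎
    where open ℚ.≤-Reasoning

open RationalDistance

-- ℝ is represented by Cauchy sequences of rationals; equality of reals is _≈_, not _≡_.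

IsCauchy : (ℕ → ℚ) → Set
IsCauchy s = ∀ ε → 0ℚ ℚ.< ε → ∃[ N ] (∀ i j → N ℕ.≤ i → N ℕ.≤ j → ∣ s i ℚ.- s j ∣ ℚ.< ε)

record ℝ : Set where
  constructor mkℝ
  field
    seq    : ℕ → ℚ
    cauchy : IsCauchy seq

open ℝ public

infix  4 _≈_ _≤_
infixl 6 _+_ _-_
infixl 7 _*_
infix  8 -_
infixl 5 _⊔_ _⊓_

_≈_ : ℝ → ℝ → Set
x ≈ y = ∀ ε → 0ℚ ℚ.< ε → ∃[ N ] (∀ i → N ℕ.≤ i → ∣ seq x i ℚ.- seq y i ∣ ℚ.< ε)

-- The slack ε makes this the non-strict order between the limits, and independent
-- of the chosen representatives.
_≤_ : ℝ → ℝ → Set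
x ≤ y = ∀ ε → 0ℚ ℚ.< ε → ∃[ N ] (∀ i → N ℕ.≤ i → seq x i ℚ.< seq y i ℚ.+ ε)

fromℚ : ℚ → ℝ
fromℚ q = mkℝ (λ _ → q) λ ε 0<ε → 0 , λ _ _ _ _ →
  subst (ℚ._< ε) (sym (cong ∣_∣ (ℚ.+-inverseʳ q))) 0<ε

0ℝ 1ℝ : ℝ
0ℝ = fromℚ 0ℚ
1ℝ = fromℚ 1ℚ

lift₂ : (f : ℚ → ℚ → ℚ) → NonExpansive f → ℝ → ℝ → ℝ
lift₂ f f-ne x y = mkℝ (λ i → f (seq x i) (seq y i)) λ ε 0<ε →
  let M , x-close = cauchy x (½ ℚ.* ε) (half-pos 0<ε)
      N , y-close = cauchy y (½ ℚ.* ε) (half-pos 0<ε)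
  in M ℕ.⊔ N , λ i j i≥ j≥ →
    ℚ.≤-<-trans (f-ne (seq x i) (seq x j) (seq y i) (seq y j))
      (subst (_ ℚ.<_) (halve ε)
        (ℚ.+-mono-<
          (x-close i j (ℕ.≤-trans (ℕ.m≤m⊔n M N) i≥) (ℕ.≤-trans (ℕ.m≤m⊔n M N) j≥))
          (y-close i j (ℕ.≤-trans (ℕ.m≤n⊔m M N) i≥) (ℕ.≤-trans (ℕ.m≤n⊔m M N) j≥))))

_+_ _⊔_ _⊓_ : ℝ → ℝ → ℝ
_+_ = lift₂ ℚ._+_ +-nonExpansive
_⊔_ = lift₂ ℚ._⊔_ ⊔-nonExpansive
_⊓_ = lift₂ ℚ._⊓_ ⊓-nonExpansive

-_ : ℝ → ℝ
- x = mkℝ (λ i → ℚ.- seq x i) λ ε 0<ε →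
  let N , close = cauchy x ε 0<ε
  in N , λ i j i≥ j≥ → subst (ℚ._< ε)
       (trans (d-sym (seq x i) (seq x j))
         (cong ∣_∣ (solve 2 (λ p q → q :- p := :- p :- (:- q)) refl (seq x i) (seq x j))))
       (close i j i≥ j≥)

_-_ : ℝ → ℝ → ℝ
x - y = x + (- y)

eventuallyBounded : ∀ x → ∃[ K ] (0ℚ ℚ.< K × ∃[ N ] (∀ i → N ℕ.≤ i → ∣ seq x i ∣ ℚ.≤ K))
eventuallyBounded x = ∣ a ∣ ℚ.+ 1ℚ , 0<K , N , bound
  where
  0<1 : 0ℚ ℚ.< 1ℚ
  0<1 = ℚ.positive⁻¹ 1ℚ
  N = proj₁ (cauchy x 1ℚ 0<1)
  a = seq x N
  0<K : 0ℚ ℚ.< ∣ a ∣ ℚ.+ 1ℚ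
  0<K = ℚ.+-mono-≤-< (ℚ.0≤∣p∣ a) 0<1
  bound : ∀ i → N ℕ.≤ i → ∣ seq x i ∣ ℚ.≤ ∣ a ∣ ℚ.+ 1ℚ
  bound i i≥ = begin
    ∣ seq x i ∣
      ≡⟨ cong ∣_∣ (solve 2 (λ p q → p := q :+ (p :- q)) refl (seq x i) a) ⟩
    ∣ a ℚ.+ (seq x i ℚ.- a) ∣
      ≤⟨ ℚ.∣p+q∣≤∣p∣+∣q∣ a (seq x i ℚ.- a) ⟩
    ∣ a ∣ ℚ.+ ∣ seq x i ℚ.- a ∣
      ≤⟨ ℚ.+-monoʳ-≤ ∣ a ∣ (ℚ.<⇒≤ (proj₂ (cauchy x 1ℚ 0<1) i N i≥ ℕ.≤-refl)) ⟩
    ∣ a ∣ ℚ.+ 1ℚ ∎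
    where open ℚ.≤-Reasoning

_*_ : ℝ → ℝ → ℝ
x * y = mkℝ (λ i → seq x i ℚ.* seq y i) λ ε 0<ε →
  let K , 0<K , A , x≤K   = eventuallyBounded x
      L , 0<L , B , y≤L   = eventuallyBounded y
      δ , 0<δ , Kδ≡       = shrink 0<K 0<ε
      η , 0<η , Lη≡       = shrink 0<L 0<ε
      M , x-close         = cauchy x η 0<η
      N , y-close         = cauchy y δ 0<δ
      A≤ = ℕ.≤-trans (ℕ.m≤m⊔n A B) (ℕ.m≤m⊔n (A ℕ.⊔ B) (M ℕ.⊔ N))
      B≤ = ℕ.≤-trans (ℕ.m≤n⊔m A B) (ℕ.m≤m⊔n (A ℕ.⊔ B) (M ℕ.⊔ N))
      M≤ = ℕ.≤-trans (ℕ.m≤m⊔n M N) (ℕ.m≤n⊔m (A ℕ.⊔ B) (M ℕ.⊔ N))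
      N≤ = ℕ.≤-trans (ℕ.m≤n⊔m M N) (ℕ.m≤n⊔m (A ℕ.⊔ B) (M ℕ.⊔ N))
  in (A ℕ.⊔ B) ℕ.⊔ (M ℕ.⊔ N) , λ i j i≥ j≥ →
    let p = seq x i; p′ = seq x j; q = seq y i; q′ = seq y j in
    subst (_ ℚ.<_) (trans (cong₂ ℚ._+_ Kδ≡ Lη≡) (halve ε))
      (ℚ.≤-<-trans (*-distance p p′ q q′)
        (ℚ.+-mono-<
          (mul-close p (q ℚ.- q′) 0<K (x≤K i (ℕ.≤-trans A≤ i≥))
            (y-close i j (ℕ.≤-trans N≤ i≥) (ℕ.≤-trans N≤ j≥)))
          (mul-close q′ (p ℚ.- p′) 0<L (y≤L j (ℕ.≤-trans B≤ j≥))
            (x-close i j (ℕ.≤-trans M≤ i≥) (ℕ.≤-trans M≤ j≥)))))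

infix 8 _·_

_·_ : Vector ℝ n → Vector ℝ n → ℝ
u · v = foldr _+_ 0ℝ (zipWith _*_ u v)

-- A square matrix is the vector of its rows, so that Q i is the i-th row.
Matrix : ℕ → Set
Matrix n = Vector (Vector ℝ n) n

IsSymmetric : Matrix n → Set
IsSymmetric Q = ∀ i j → Q i j ≈ Q j i

-- Subsets of ℝ and ℝⁿ are arbitrary predicates: they need not respect _≈_, which
-- includes the extensional ones as a special case.

ZeroOne : Pred (Vector ℝ n) 0ℓ
ZeroOne x = ∀ i → x i ≈ 0ℝ ⊎ x i ≈ 1ℝ

Image : (Vector ℝ n → ℝ) → Pred (Vector ℝ n) ℓ → Pred ℝ ℓ
Image f S r = ∃[ x ] (x ∈ S × r ≈ f x)

IsMinimum IsMaximum : Pred ℝ ℓ → ℝ → Set ℓ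
IsMinimum A r = r ∈ A × (∀ {a} → a ∈ A → r ≤ a)
IsMaximum A r = r ∈ A × (∀ {a} → a ∈ A → a ≤ r)

{-# OPTIONS --safe #-}

-- Since X ⊆ X̄, the number p = Q i · x lies between γmin i and γmax i. At x i = 0 the
-- two arguments of the maximum are 0 and p - γmax i ≤ 0, at x i = 1 they are γmin i
-- and p; the minimum is dual.
module Submission where

open import Defs
open import Data.Nat.Base as ℕ using (ℕ)
import Data.Nat.Properties as ℕ
open import Data.Product.Base using (_×_; _,_; proj₂)
open import Data.Rational.Base as ℚ using (ℚ; 0ℚ; 1ℚ; ½; ∣_∣)
import Data.Rational.Properties as ℚ
open import Data.Rational.Solver using (module +-*-Solver)
open import Data.Sum.Base using (_⊎_; inj₁; inj₂)
open import Data.Vec.Functional using (Vector)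
open import Level using (Level; 0ℓ)
open import Relation.Binary.Bundles using (Setoid)
open import Relation.Binary.PropositionalEquality
  using (_≡_; refl; sym; trans; cong; cong₂; subst; subst₂)
import Relation.Binary.Reasoning.Setoid as SetoidReasoning
open import Relation.Unary using (Pred; _∈_; _⊆_)

open RationalDistance
open +-*-Solver

½ε<ε : ∀ {ε} → 0ℚ ℚ.< ε → ½ ℚ.* ε ℚ.< ε
½ε<ε {ε} 0<ε = subst₂ ℚ._<_ (ℚ.+-identityʳ (½ ℚ.* ε)) (halve ε)
  (ℚ.+-monoʳ-< (½ ℚ.* ε) (half-pos 0<ε))

p≤p+δ : ∀ p {δ} → 0ℚ ℚ.≤ δ → p ℚ.≤ p ℚ.+ δ
p≤p+δ p 0≤δ = +-mono-pos p 0≤δ ℚ.≤-refl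

-- An inequality between reals gives one between their terms only up to a slack `δ`, so `p ⊔ q` may
-- overshoot `q`, but by no more than `δ`.
⊔-near : ∀ p q {δ} → 0ℚ ℚ.≤ δ → p ℚ.≤ q ℚ.+ δ → ∣ p ℚ.⊔ q ℚ.- q ∣ ℚ.≤ δ
⊔-near p q 0≤δ p≤q+δ = d≤ (p ℚ.⊔ q) q
  (ℚ.⊔-lub p≤q+δ (p≤p+δ q 0≤δ))
  (ℚ.≤-trans (ℚ.p≤q⊔p p q) (p≤p+δ (p ℚ.⊔ q) 0≤δ))

⊓-near : ∀ p q {δ} → 0ℚ ℚ.≤ δ → p ℚ.≤ q ℚ.+ δ → ∣ p ℚ.⊓ q ℚ.- p ∣ ℚ.≤ δ
⊓-near p q {δ} 0≤δ p≤q+δ = d≤ (p ℚ.⊓ q) p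
  (ℚ.≤-trans (ℚ.p⊓q≤p p q) (p≤p+δ p 0≤δ))
  -- Adding `δ` is monotone, hence distributes over the minimum, and it suffices to bound `p` by
  -- `p + δ` and by `q + δ`.
  (subst (p ℚ.≤_) (sym (ℚ.mono-≤-distrib-⊓ (ℚ.+-monoˡ-≤ δ) p q))
    (ℚ.⊓-glb (p≤p+δ p 0≤δ) p≤q+δ))

-- Reduces an identity of reals to one of rationals, index by index.
pointwise : ∀ x y → (∀ i → seq x i ≡ seq y i) → x ≈ y
pointwise x y eq ε 0<ε = 0 , λ i _ → subst (ℚ._< ε)
  (sym (cong ∣_∣ (trans (cong (ℚ._- seq y i) (eq i)) (ℚ.+-inverseʳ (seq y i))))) 0<ε

≈-refl : ∀ x → x ≈ x
≈-refl x = pointwise x x λ _ → refl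

≈-sym : ∀ x y → x ≈ y → y ≈ x
≈-sym x y x≈y ε 0<ε =
  let N , close = x≈y ε 0<ε
  in N , λ i i≥ → subst (ℚ._< ε) (d-sym (seq x i) (seq y i)) (close i i≥)

lift₂-cong : ∀ f (f-ne : NonExpansive f) x x′ y y′ → x ≈ x′ → y ≈ y′ →
             lift₂ f f-ne x y ≈ lift₂ f f-ne x′ y′
lift₂-cong f f-ne x x′ y y′ x≈x′ y≈y′ ε 0<ε =
  let M , x-close = x≈x′ (½ ℚ.* ε) (half-pos 0<ε)
      N , y-close = y≈y′ (½ ℚ.* ε) (half-pos 0<ε)
  in M ℕ.⊔ N , λ i i≥ →
    ℚ.≤-<-trans (f-ne (seq x i) (seq x′ i) (seq y i) (seq y′ i))
      (subst (_ ℚ.<_) (halve ε)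
        (ℚ.+-mono-< (x-close i (ℕ.≤-trans (ℕ.m≤m⊔n M N) i≥))
                    (y-close i (ℕ.≤-trans (ℕ.m≤n⊔m M N) i≥))))

≈-trans : ∀ x y z → x ≈ y → y ≈ z → x ≈ z
≈-trans x y z x≈y y≈z ε 0<ε =
  -- Transitivity comes from congruence of addition: the middle term cancels in the difference of
  -- `x + y` and `y + z`.
  let N , close = lift₂-cong ℚ._+_ +-nonExpansive x y y z x≈y y≈z ε 0<ε
  in N , λ i i≥ → subst (ℚ._< ε)
       (cong ∣_∣ (solve 3 (λ p q r → p :+ q :- (q :+ r) := p :- r) refl
         (seq x i) (seq y i) (seq z i)))
       (close i i≥)

ℝ-setoid : Setoid 0ℓ 0ℓ
ℝ-setoid = record
  { Carrier       = ℝ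
  ; _≈_           = _≈_
  ; isEquivalence = record
    { refl  = λ {x} → ≈-refl x
    ; sym   = λ {x y} → ≈-sym x y
    ; trans = λ {x y z} → ≈-trans x y z
    }
  }

+-cong : ∀ x x′ y y′ → x ≈ x′ → y ≈ y′ → x + y ≈ x′ + y′
+-cong = lift₂-cong ℚ._+_ +-nonExpansive

-- Multiplication is not non-expansive, so `lift₂-cong` does not apply. Instead the fixed factor is
-- eventually bounded by some `K`, and `δ` is chosen with `K * δ` equal to half of `ε`.
*-congˡ : ∀ a x x′ → x ≈ x′ → a * x ≈ a * x′
*-congˡ a x x′ x≈x′ ε 0<ε =
  let K , 0<K , M , a≤K = eventuallyBounded a
      δ , 0<δ , Kδ≡     = shrink 0<K 0<ε
      N , close         = x≈x′ δ 0<δ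
  in M ℕ.⊔ N , λ i i≥ →
    let p = seq a i; q = seq x i; q′ = seq x′ i in
    subst (ℚ._< ε)
      (cong ∣_∣ (solve 3 (λ p q q′ → p :* (q :- q′) := p :* q :- p :* q′) refl p q q′))
      (ℚ.<-trans
        (subst (_ ℚ.<_) Kδ≡
          (mul-close p (q ℚ.- q′) 0<K (a≤K i (ℕ.≤-trans (ℕ.m≤m⊔n M N) i≥))
            (close i (ℕ.≤-trans (ℕ.m≤n⊔m M N) i≥))))
        (½ε<ε 0<ε))

*-comm : ∀ x y → x * y ≈ y * x
*-comm x y = pointwise (x * y) (y * x) λ i → ℚ.*-comm (seq x i) (seq y i)

⊔-comm : ∀ x y → x ⊔ y ≈ y ⊔ x
⊔-comm x y = pointwise (x ⊔ y) (y ⊔ x) λ i → ℚ.⊔-comm (seq x i) (seq y i)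

⊓-comm : ∀ x y → x ⊓ y ≈ y ⊓ x
⊓-comm x y = pointwise (x ⊓ y) (y ⊓ x) λ i → ℚ.⊓-comm (seq x i) (seq y i)

-- `⊔-near` yields only a non-strict bound; applying it at half of `ε` leaves room for the strict
-- one.
x≤y⇒x⊔y≈y : ∀ x y → x ≤ y → x ⊔ y ≈ y
x≤y⇒x⊔y≈y x y x≤y ε 0<ε =
  let N , below = x≤y (½ ℚ.* ε) (half-pos 0<ε)
  in N , λ i i≥ → ℚ.≤-<-trans
       (⊔-near (seq x i) (seq y i) (ℚ.<⇒≤ (half-pos 0<ε)) (ℚ.<⇒≤ (below i i≥)))
       (½ε<ε 0<ε)

x≤y⇒x⊓y≈x : ∀ x y → x ≤ y → x ⊓ y ≈ x
x≤y⇒x⊓y≈x x y x≤y ε 0<ε =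
  let N , below = x≤y (½ ℚ.* ε) (half-pos 0<ε)
  in N , λ i i≥ → ℚ.≤-<-trans
       (⊓-near (seq x i) (seq y i) (ℚ.<⇒≤ (half-pos 0<ε)) (ℚ.<⇒≤ (below i i≥)))
       (½ε<ε 0<ε)

x≤y⇒x-y≤0 : ∀ x y → x ≤ y → x - y ≤ 0ℝ
x≤y⇒x-y≤0 x y x≤y ε 0<ε =
  let N , below = x≤y ε 0<ε
  in N , λ i i≥ → subst (seq x i ℚ.- seq y i ℚ.<_)
       (solve 2 (λ q e → q :+ e :- q := con 0ℚ :+ e) refl (seq y i) ε)
       (ℚ.+-monoˡ-< (ℚ.- seq y i) (below i i≥))

x≤y⇒0≤y-x : ∀ x y → x ≤ y → 0ℝ ≤ y - x
x≤y⇒0≤y-x x y x≤y ε 0<ε =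
  let N , below = x≤y ε 0<ε
  in N , λ i i≥ → subst₂ ℚ._<_
       (ℚ.+-inverseʳ (seq x i))
       (solve 3 (λ p q e → q :+ e :- p := q :- p :+ e) refl (seq x i) (seq y i) ε)
       (ℚ.+-monoˡ-< (ℚ.- seq x i) (below i i≥))

-- Both formulas have the same shape: `f` is the maximum with `a`, `b` the lower and upper bound, or
-- the minimum with the bounds exchanged.
module _ (f : ℚ → ℚ → ℚ) (f-ne : NonExpansive f) (a b p : ℝ) where

  private
    infixl 5 _∙_
    _∙_ : ℝ → ℝ → ℝ
    _∙_ = lift₂ f f-ne

    rhs : ℝ → ℝ
    rhs t = (a * t) ∙ (p + b * t - b)

    -- A binary coordinate is 0 or 1 only up to `_≈_`, so its value has to be substituted by
    -- congruence.
    rhs-cong : ∀ t t′ → t ≈ t′ → rhs t ≈ rhs t′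
    rhs-cong t t′ t≈t′ =
      lift₂-cong f f-ne (a * t) (a * t′) (p + b * t - b) (p + b * t′ - b)
        (*-congˡ a t t′ t≈t′)
        (+-cong (p + b * t) (p + b * t′) (- b) (- b)
          (+-cong p p (b * t) (b * t′) (≈-refl p) (*-congˡ b t t′ t≈t′))
          (≈-refl (- b)))

    rhs-0 : rhs 0ℝ ≈ 0ℝ ∙ (p - b)
    rhs-0 = pointwise (rhs 0ℝ) (0ℝ ∙ (p - b)) λ i → cong₂ f
      (ℚ.*-zeroʳ (seq a i))
      (solve 2 (λ p b → p :+ b :* con 0ℚ :- b := p :- b) refl (seq p i) (seq b i))

    rhs-1 : rhs 1ℝ ≈ a ∙ p
    rhs-1 = pointwise (rhs 1ℝ) (a ∙ p) λ i → cong₂ f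
      (ℚ.*-identityʳ (seq a i))
      (solve 2 (λ p b → p :+ b :* con 1ℚ :- b := p) refl (seq p i) (seq b i))

  -- Order enters only through the two endpoint equations; everything else is ring arithmetic at `t`
  -- equal to 0 or 1.
  binary-product : ∀ t → t ≈ 0ℝ ⊎ t ≈ 1ℝ → 0ℝ ∙ (p - b) ≈ 0ℝ → a ∙ p ≈ p →
                   t * p ≈ (a * t) ∙ (p + b * t - b)
  binary-product t (inj₁ t≈0) at-0 _ = begin
    -- Commuting puts `t` on the right, where `*-congˡ` can replace it.
    t * p         ≈⟨ *-comm t p ⟩
    p * t         ≈⟨ *-congˡ p t 0ℝ t≈0 ⟩
    p * 0ℝ        ≈⟨ pointwise (p * 0ℝ) 0ℝ (λ i → ℚ.*-zeroʳ (seq p i)) ⟩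
    0ℝ            ≈⟨ at-0 ⟨
    0ℝ ∙ (p - b)  ≈⟨ rhs-0 ⟨
    rhs 0ℝ        ≈⟨ rhs-cong t 0ℝ t≈0 ⟨
    rhs t         ∎
    where open SetoidReasoning ℝ-setoid
  binary-product t (inj₂ t≈1) _ at-1 = begin
    t * p         ≈⟨ *-comm t p ⟩
    p * t         ≈⟨ *-congˡ p t 1ℝ t≈1 ⟩
    p * 1ℝ        ≈⟨ pointwise (p * 1ℝ) p (λ i → ℚ.*-identityʳ (seq p i)) ⟩
    p             ≈⟨ at-1 ⟨
    a ∙ p         ≈⟨ rhs-1 ⟨
    rhs 1ℝ        ≈⟨ rhs-cong t 1ℝ t≈1 ⟨
    rhs t         ∎
    where open SetoidReasoning ℝ-setoid

lemma3p1 : {ℓ₁ ℓ₂ : Level} (n : ℕ)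
    (X : Pred (Vector ℝ n) ℓ₁) → X ⊆ ZeroOne →
    (Q : Matrix n) → IsSymmetric Q →
    (X̄ : Pred (Vector ℝ n) ℓ₂) → X ⊆ X̄ →
    (γmin γmax : Vector ℝ n) →
    (∀ i → IsMinimum (Image (λ x → Q i · x) X̄) (γmin i)) →
    (∀ i → IsMaximum (Image (λ x → Q i · x) X̄) (γmax i)) →
    ∀ x → x ∈ X → ∀ i →
    (x i * (Q i · x) ≈ (γmin i * x i) ⊔ ((Q i · x) + γmax i * x i - γmax i))
    × (x i * (Q i · x) ≈ (γmax i * x i) ⊓ ((Q i · x) + γmin i * x i - γmin i))
lemma3p1 n X X⊆01 Q _ X̄ X⊆X̄ γmin γmax isMin isMax x x∈X i =
    binary-product ℚ._⊔_ ⊔-nonExpansive l u p (x i) (X⊆01 x∈X i)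
      (≈-trans (0ℝ ⊔ (p - u)) ((p - u) ⊔ 0ℝ) 0ℝ (⊔-comm 0ℝ (p - u))
        (x≤y⇒x⊔y≈y (p - u) 0ℝ (x≤y⇒x-y≤0 p u p≤u)))
      (x≤y⇒x⊔y≈y l p l≤p)
  -- The bounds trade places: `l ≤ p` now settles the endpoint 0 and `p ≤ u` the endpoint 1.
  , binary-product ℚ._⊓_ ⊓-nonExpansive u l p (x i) (X⊆01 x∈X i)
      (x≤y⇒x⊓y≈x 0ℝ (p - l) (x≤y⇒0≤y-x l p l≤p))
      (≈-trans (u ⊓ p) (p ⊓ u) p (⊓-comm u p) (x≤y⇒x⊓y≈x p u p≤u))
  where
  p = Q i · x
  l = γmin i
  u = γmax i
  p∈image : p ∈ Image (λ x → Q i · x) X̄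
  -- The point `x` itself is feasible for the relaxation, so `p` is among the values that `l` and
  -- `u` bound.
  p∈image = x , X⊆X̄ x∈X , ≈-refl p
  l≤p : l ≤ p
  l≤p = proj₂ (isMin i) {p} p∈image
  p≤u : p ≤ u
  p≤u = proj₂ (isMax i) {p} p∈image
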